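{- Let $\alpha \leq \kappa(\mathfrak{Small})$ be a regular cardinal and let $\mathfrak{J}_\alpha$ be a set of $\alpha$-small sets containing all $\alpha$-small cardinals. Let $G$ be a set of $\mathfrak{J}_\alpha$-ary operations on a small set $A$, and let $f:A^J \rightarrow A$ be an operation with $J \in \mathfrak{J}_\alpha$. The following are equivalent: (1) $f \in G^\perp$, i.e. $f$ is an element of the $\mathfrak{J}_\alpha$-ary centralizer clone of $G$; (2) $h(f) = f(h \circ u_J)$ for every operation $h:A^{(A^J)} \rightarrow A$ of arity $A^J$ in the $\mathfrak{Small}$-ary clone $\langle G\rangle$ generated by $G$, where $u_J:J \rightarrow A^{(A^J)}$ is the map that sends each $j \in J$ to the projection $\pi_j:A^J \rightarrow A$; (3) $f$ commutes with every operation $h:A^{(A^J)} \rightarrow A$ of arity $A^J$ in $\langle G\rangle$.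
   Context: Fix a Grothendieck universe $\mathfrak{Small}$, i.e. the set of all sets of rank less than a fixed inaccessible cardinal $\kappa = \kappa(\mathfrak{Small})$; its elements are called small sets. Let $\alpha \leq \kappa(\mathfrak{Small})$ be an (infinite) regular cardinal. A set is $\alpha$-small if it is small and has cardinality less than $\alpha$. Fix a set $\mathfrak{J}_\alpha$ of sets with $\mathfrak{Card}_\alpha \subseteq \mathfrak{J}_\alpha \subseteq \mathfrak{Small}_\alpha$, where $\mathfrak{Card}_\alpha$ is the set of all $\alpha$-small cardinals and $\mathfrak{Small}_\alpha$ is the set of all $\alpha$-small sets. Given a set $A$, an operation on $A$ of arity $J$ is a map $A^J \to A$, where $J$ is a set; it is $\mathfrak{J}_\alpha$-ary if $J \in \mathfrak{J}_\alpha$, and $\mathfrak{Small}$-ary if $J$ is a small set (the latter is the case $\alpha=\kappa(\mathfrak{Small})$, $\mathfrak{J}_\alpha=\mathfrak{Small}$). Nullary operations ($J=\emptyset$) are allowed. A set of $\mathfrak{J}_\alpha$-ary operations on $A$ is a subset of the disjoint union $\coprod_{J \in \mathfrak{J}_\alpha} A^{(A^J)}$ of all $\mathfrak{J}_\alpha$-ary operations. A $\mathfrak{Small}$-ary clone on $A$ is a set $F$ of $\mathfrak{Small}$-ary operations on $A$ that contains all projections $\pi_x:A^X\to A$ ($X$ small, $x\in X$) and is such that for all small $X,Y$, every $f:A^Y\to A$ in $F$ and every family $g_y:A^X\to A$ $(y\in Y)$ in $F$, the composite $f\circ(g_y)_{y\in Y}:A^X\to A$ lies in $F$. Any set $G$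 of $\mathfrak{J}_\alpha$-ary operations is also a set of $\mathfrak{Small}$-ary operations, and $\langle G\rangle$ denotes the smallest $\mathfrak{Small}$-ary clone on $A$ containing $G$. Operations $f:A^X\to A$ and $g:A^Y\to A$ commute, written $f\perp g$, if for every matrix $a=(a_{xy})\in A^{X\times Y}$ one has $g\bigl((f((a_{xy})_{x\in X}))_{y\in Y}\bigr)=f\bigl((g((a_{xy})_{y\in Y}))_{x\in X}\bigr)$. The $\mathfrak{J}_\alpha$-ary centralizer (clone) $G^\perp$ of $G$ is the set of all $\mathfrak{J}_\alpha$-ary operations $f$ on $A$ with $f\perp g$ for all $g\in G$. In $h(f)$, the map $f:A^J\to A$ is regarded as an element of $A^{(A^J)}$; and $h\circ u_J: J\to A$ is regarded as an element of $A^J$. -}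

module Defs where

open import Level using (Level; _⊔_; suc)
open import Data.Fin.Base using (Fin)
open import Data.Nat.Base using (ℕ)
open import Data.Product.Base using (Σ; ∃; ∃-syntax; _×_; _,_; proj₁)
open import Data.Product.Relation.Binary.Pointwise.NonDependent using (_×ₛ_)
open import Data.Unit.Polymorphic.Base using (⊤)
open import Function.Bundles using (Func; _⟨$⟩_; Injection; Inverse)
open import Function.Construct.Composition using (function)
open import Function.Relation.Binary.Setoid.Equality using (_⇨_)
open import Induction.WellFounded using (WellFounded)
open import Relation.Binary.Bundles using (Setoid; StrictTotalOrder)
import Relation.Binary.Construct.On as On
import Relation.Binary.PropositionalEquality.Properties as ≡
import Relation.Binary.Reasoning.Setoid as SetoidReasoning
open import Relation.Nullary.Negation.Core using (¬_)
open import Relation.Unary using (Pred)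

-- The small sets are the setoids in `Setoid ℓ ℓ`, and maps between sets are
-- `Func`s, so that A^X is again a small set, with extensional equality.

------------------------------------------------------------------------
-- Cardinals

Segment : ∀ {ℓ} (W : StrictTotalOrder ℓ ℓ ℓ) → StrictTotalOrder.Carrier W → Setoid ℓ ℓ
Segment W β = On.setoid (StrictTotalOrder.Eq.setoid W) (proj₁ {B = λ γ → γ < β})
  where open StrictTotalOrder W

-- Ordinals are small well-ordered sets; a cardinal is an initial ordinal,
-- that is, one not equinumerous to any of its proper initial segments.

record Cardinal (ℓ : Level) : Set (suc ℓ) where
  field
    order       : StrictTotalOrder ℓ ℓ ℓ
  open StrictTotalOrder order public using (Carrier; _<_)
  field
    wellFounded : WellFounded _<_
    initial     : ∀ β → ¬ Inverse (Segment order β) (StrictTotalOrder.Eq.setoid order)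

  set : Setoid ℓ ℓ
  set = StrictTotalOrder.Eq.setoid order

-- An infinite cardinal is regular if no map into it from a smaller ordinal is
-- cofinal; smaller ordinals are the proper initial segments.

record IsRegular {ℓ} (α : Cardinal ℓ) : Set ℓ where
  open Cardinal α
  field
    infinite : ∀ (n : ℕ) → ¬ Inverse (≡.setoid (Fin n)) set
    bounded  : ∀ β (F : Func (Segment order β) set) → ∃[ γ ] (∀ b → (F ⟨$⟩ b) < γ)

-- κ is the cardinal of the universe itself, which is not small.

data RegularCardinal≤κ (ℓ : Level) : Set (suc ℓ) where
  small : (α : Cardinal ℓ) → IsRegular α → RegularCardinal≤κ ℓ
  κ     : RegularCardinal≤κ ℓ

-- |X| < |α| means |X| ≤ |α| and |X| ≠ |α|.  Every small set has cardinality
-- less than κ.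

IsSmall : ∀ {ℓ} → RegularCardinal≤κ ℓ → Setoid ℓ ℓ → Set ℓ
IsSmall (small α _) X = Injection X (Cardinal.set α) × ¬ Inverse X (Cardinal.set α)
IsSmall κ           X = ⊤

-- The same cardinal has many isomorphic representatives here, in contrast to
-- von Neumann cardinals, so Card_α ⊆ 𝔍 only asks for one set in 𝔍 representing
-- each α-small cardinal.

record IsArities {ℓ j} (α : RegularCardinal≤κ ℓ) (𝔍 : Pred (Setoid ℓ ℓ) j) : Set (suc ℓ ⊔ j) where
  field
    𝔍⊆Small : ∀ {X} → 𝔍 X → IsSmall α X
    Card⊆𝔍  : ∀ (Λ : Cardinal ℓ) → IsSmall α (Cardinal.set Λ) →
              ∃[ X ] 𝔍 X × Inverse X (Cardinal.set Λ)

------------------------------------------------------------------------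
-- Operations

infixl 10 _^_
_^_ : ∀ {ℓ} → Setoid ℓ ℓ → Setoid ℓ ℓ → Setoid ℓ ℓ
A ^ X = X ⇨ A

Op : ∀ {ℓ} → Setoid ℓ ℓ → Setoid ℓ ℓ → Set ℓ
Op A X = Func (A ^ X) A

-- As operations, f and f′ are equal when they are equal in A^(A^X).

EqOp : ∀ {ℓ} (A X : Setoid ℓ ℓ) → Op A X → Op A X → Set ℓ
EqOp A X = Setoid._≈_ (A ^ (A ^ X))

proj : ∀ {ℓ} (A X : Setoid ℓ ℓ) → Func X (A ^ (A ^ X))
proj A X = record
  { to   = λ x → record { to = λ a → a ⟨$⟩ x ; cong = λ a≈b → a≈b x }
  ; cong = λ x≈y a → Func.cong a x≈y
  }

tuple : ∀ {ℓ} {A X Y : Setoid ℓ ℓ} → Func Y (A ^ (A ^ X)) → Func (A ^ X) (A ^ Y)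
tuple g = record
  { to   = λ a → record { to = λ y → (g ⟨$⟩ y) ⟨$⟩ a ; cong = λ y≈z → Func.cong g y≈z a }
  ; cong = λ a≈b y → Func.cong (g ⟨$⟩ y) a≈b
  }

compose : ∀ {ℓ} {A X Y : Setoid ℓ ℓ} → Op A Y → Func Y (A ^ (A ^ X)) → Op A X
compose f g = function (tuple g) f


module _ {ℓ} {A X Y : Setoid ℓ ℓ} (a : Func (X ×ₛ Y) A) where

  column : Setoid.Carrier Y → Func X A
  column y = record { to = λ x → a ⟨$⟩ (x , y) ; cong = λ x≈x′ → Func.cong a (x≈x′ , Setoid.refl Y) }

  row : Setoid.Carrier X → Func Y A
  row x = record { to = λ y → a ⟨$⟩ (x , y) ; cong = λ y≈y′ → Func.cong a (Setoid.refl X , y≈y′) }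

  onColumns : Op A X → Func Y A
  onColumns f = record
    { to   = λ y → f ⟨$⟩ column y
    ; cong = λ y≈y′ → Func.cong f (λ x → Func.cong a (Setoid.refl X , y≈y′))
    }

  onRows : Op A Y → Func X A
  onRows g = record
    { to   = λ x → g ⟨$⟩ row x
    ; cong = λ x≈x′ → Func.cong g (λ y → Func.cong a (x≈x′ , Setoid.refl Y))
    }

Commute : ∀ {ℓ} (A X Y : Setoid ℓ ℓ) → Op A X → Op A Y → Set ℓ
Commute A X Y f g = ∀ (a : Func (X ×ₛ Y) A) → (g ⟨$⟩ onColumns a f) ≈ (f ⟨$⟩ onRows a g)
  where open Setoid A

------------------------------------------------------------------------
-- Sets of operations

record OpSet {ℓ} (A : Setoid ℓ ℓ) (p : Level) : Set (suc (ℓ ⊔ p)) where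
  field
    mem  : ∀ X → Op A X → Set p
    resp : ∀ {X f f′} → EqOp A X f f′ → mem X f → mem X f′

open OpSet public using (mem)

IsAry : ∀ {ℓ j p} {A : Setoid ℓ ℓ} → Pred (Setoid ℓ ℓ) j → OpSet A p → Set (suc ℓ ⊔ j ⊔ p)
IsAry 𝔍 G = ∀ {X f} → mem G X f → 𝔍 X

record IsClone {ℓ p} {A : Setoid ℓ ℓ} (F : OpSet A p) : Set (suc ℓ ⊔ p) where
  field
    proj∈    : ∀ X x → mem F X (proj A X ⟨$⟩ x)
    compose∈ : ∀ {X Y} (f : Op A Y) (g : Func Y (A ^ (A ^ X))) →
               mem F Y f → (∀ y → mem F X (g ⟨$⟩ y)) → mem F X (compose f g)

data Generated {ℓ p} {A : Setoid ℓ ℓ} (G : OpSet A p) : ∀ X → Op A X → Set (suc ℓ ⊔ p) where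
  gen  : ∀ {X f} → mem G X f → Generated G X f
  prj  : ∀ X x → Generated G X (proj A X ⟨$⟩ x)
  cmp  : ∀ {X Y} (f : Op A Y) (g : Func Y (A ^ (A ^ X))) →
         Generated G Y f → (∀ y → Generated G X (g ⟨$⟩ y)) → Generated G X (compose f g)
  ext  : ∀ {X f f′} → EqOp A X f f′ → Generated G X f → Generated G X f′

⟨_⟩ : ∀ {ℓ p} {A : Setoid ℓ ℓ} → OpSet A p → OpSet A (suc ℓ ⊔ p)
⟨ G ⟩ = record { mem = Generated G ; resp = ext }

-- ⟨ G ⟩ is the smallest clone containing G.

⟨⟩-isClone : ∀ {ℓ p} {A : Setoid ℓ ℓ} (G : OpSet A p) → IsClone ⟨ G ⟩
⟨⟩-isClone G = record { proj∈ = prj ; compose∈ = cmp }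

⟨⟩-contains : ∀ {ℓ p} {A : Setoid ℓ ℓ} (G : OpSet A p) {X f} → mem G X f → mem ⟨ G ⟩ X f
⟨⟩-contains G = gen

⟨⟩-least : ∀ {ℓ p q} {A : Setoid ℓ ℓ} (G : OpSet A p) (F : OpSet A q) → IsClone F →
           (∀ {X f} → mem G X f → mem F X f) → ∀ {X f} → mem ⟨ G ⟩ X f → mem F X f
⟨⟩-least G F F-clone G⊆F = go
  where
  open IsClone F-clone
  go : ∀ {X f} → Generated G X f → mem F X f
  go (gen f∈G)       = G⊆F f∈G
  go (prj X x)       = proj∈ X x
  go (cmp f g f∈ g∈) = compose∈ f g (go f∈) (λ y → go (g∈ y))
  go (ext f≈f′ f∈)   = OpSet.resp F f≈f′ (go f∈)

Commute-resp : ∀ {ℓ} (A X Y : Setoid ℓ ℓ) (f f′ : Op A X) (g : Op A Y) →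
               EqOp A X f f′ → Commute A X Y f g → Commute A X Y f′ g
Commute-resp A X Y f f′ g f≈f′ f⊥g a = begin
  g ⟨$⟩ onColumns a f′ ≈⟨ Func.cong g (λ y → f≈f′ (column a y)) ⟨
  g ⟨$⟩ onColumns a f  ≈⟨ f⊥g a ⟩
  f ⟨$⟩ onRows a g     ≈⟨ f≈f′ (onRows a g) ⟩
  f′ ⟨$⟩ onRows a g    ∎
  where open SetoidReasoning A

Centralizer : ∀ {ℓ j p} {A : Setoid ℓ ℓ} → Pred (Setoid ℓ ℓ) j → OpSet A p → OpSet A (suc ℓ ⊔ j ⊔ p)
Centralizer {A = A} 𝔍 G = record
  { mem  = λ X f → 𝔍 X × (∀ Y (g : Op A Y) → mem G Y g → Commute A X Y f g)
  ; resp = λ {X} {f} {f′} f≈f′ (X∈𝔍 , f⊥G) →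
      X∈𝔍 , λ Y g g∈G → Commute-resp A X Y f f′ g f≈f′ (f⊥G Y g g∈G)
  }

{-# OPTIONS --safe #-}
module Submission where

open import Defs
open import Data.Product.Base using (_×_; _,_)
open import Data.Product.Relation.Binary.Pointwise.NonDependent using (_×ₛ_)
open import Function.Base using (_∘_)
open import Function.Bundles using (Func; _⟨$⟩_; _⇔_; mk⇔)
open import Function.Construct.Composition using (function)
open import Relation.Binary.Bundles using (Setoid)
import Relation.Binary.Reasoning.Setoid as SetoidReasoning
open import Relation.Unary using (Pred)

-- The operations commuting with f form a clone, so f commutes with ⟨G⟩ as soon
-- as it commutes with G.  The identity h(f) = f(h ∘ u_J) is commutation of f
-- and h on the single evaluation matrix (x_j), j ∈ J, x ∈ A^J.  This matrix is
-- universal: every matrix a ∈ A^(J×Y) is obtained from it by selecting its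
-- columns, and for g ∈ G of arity Y the commutation of f and g on a is the
-- identity for h = g ∘ (π_(a_y))_(y∈Y), where a_y ∈ A^J is the y-th column of a.

module _ {ℓ} {A : Setoid ℓ ℓ} where

  open Setoid A using (refl)

  evaluationMatrix : (J : Setoid ℓ ℓ) → Func (J ×ₛ (A ^ J)) A
  evaluationMatrix J = record
    { to   = λ (j , x) → x ⟨$⟩ j
    ; cong = λ { {_ , x} {j′ , _} (j≈j′ , x≈x′) → Setoid.trans A (Func.cong x j≈j′) (x≈x′ j′) }
    }

  -- The intermediate matrix for composites: its column at `y` is `onRows a (g ⟨$⟩ y)`, and its row
  -- at `j` is `tuple g` of `row a j`.
  applyToRows : ∀ {J X Y : Setoid ℓ ℓ} → Func (J ×ₛ X) A → Func Y (A ^ (A ^ X)) → Func (J ×ₛ Y) A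
  applyToRows {X = X} a g = record
    { to   = λ (j , y) → (g ⟨$⟩ y) ⟨$⟩ row a j
    ; cong = λ { {j , y} {j′ , y′} (j≈j′ , y≈y′) → Setoid.trans A
        (Func.cong (g ⟨$⟩ y) (λ x → Func.cong a (j≈j′ , Setoid.refl X)))
        (Func.cong g y≈y′ (row a j′)) }
    }

  columnProjections : ∀ {J Y : Setoid ℓ ℓ} → Func (J ×ₛ Y) A → Func Y (A ^ (A ^ (A ^ J)))
  columnProjections {J} a = record
    { to   = λ y → proj A (A ^ J) ⟨$⟩ column a y
    ; cong = λ y≈y′ φ → Func.cong φ (λ j → Func.cong a (Setoid.refl J , y≈y′))
    }

  module _ {p} (G : OpSet A p) {J : Setoid ℓ ℓ} (f : Op A J) where

    commute-⟨⟩ : (∀ Y (g : Op A Y) → mem G Y g → Commute A J Y f g) →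
                 ∀ {Y} {h : Op A Y} → mem ⟨ G ⟩ Y h → Commute A J Y f h
    commute-⟨⟩ f⊥G (gen g∈G) = f⊥G _ _ g∈G
    -- Both sides are `f` applied to column `x` of `a`.
    commute-⟨⟩ f⊥G (prj X x) a = Func.cong f (λ j → refl)
    commute-⟨⟩ f⊥G (cmp h g h∈ g∈) a = begin
      compose h g ⟨$⟩ onColumns a f
        -- Induction for each `g ⟨$⟩ y` on `a` carries `f` past the inner operations; what remains
        -- is to carry it past `h` on `b`.
        ≈⟨ Func.cong h (λ y → Setoid.trans A (commute-⟨⟩ f⊥G (g∈ y) a) (Func.cong f (λ j → refl))) ⟩
      h ⟨$⟩ onColumns b f
        ≈⟨ commute-⟨⟩ f⊥G h∈ b ⟩
      f ⟨$⟩ onRows b h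
        ≈⟨ Func.cong f (λ j → Func.cong h (λ y → refl)) ⟩
      f ⟨$⟩ onRows a (compose h g) ∎
      where
      open SetoidReasoning A
      b = applyToRows a g
    commute-⟨⟩ f⊥G (ext {f = h} {f′ = h′} h≈h′ h∈) a = begin
      h′ ⟨$⟩ onColumns a f ≈⟨ h≈h′ (onColumns a f) ⟨
      h ⟨$⟩ onColumns a f  ≈⟨ commute-⟨⟩ f⊥G h∈ a ⟩
      f ⟨$⟩ onRows a h     ≈⟨ Func.cong f (λ j → h≈h′ (row a j)) ⟩
      f ⟨$⟩ onRows a h′    ∎
      where open SetoidReasoning A

  -- Column `x` of the evaluation matrix is `x` itself, so `f` on the columns gives back `f`; row
  -- `j` is the projection at `j`, so `h` on the rows gives the composite of `h` with `proj A J`.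
  commute⇒evaluation : ∀ {J : Setoid ℓ ℓ} (f : Op A J) (h : Op A (A ^ J)) →
                       Commute A J (A ^ J) f h →
                       Setoid._≈_ A (h ⟨$⟩ f) (f ⟨$⟩ function (proj A J) h)
  commute⇒evaluation {J} f h f⊥h = begin
    h ⟨$⟩ f                       ≈⟨ Func.cong h (λ x → Func.cong f (λ j → refl)) ⟩
    h ⟨$⟩ onColumns e f           ≈⟨ f⊥h e ⟩
    f ⟨$⟩ onRows e h              ≈⟨ Func.cong f (λ j → Func.cong h (λ x → refl)) ⟩
    f ⟨$⟩ function (proj A J) h   ∎
    where
    open SetoidReasoning A
    e = evaluationMatrix J

  -- The projection at `column a y` sends `f` to `f ⟨$⟩ column a y` and the projection at `j` to the
  -- entry of `a` at `(j , y)`. Hence `h` at `f` is `g` on the values of `f` on the columns, and `h`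
  -- at the projection at `j` is `g` on row `j`.
  evaluation⇒commute : ∀ {J Y : Setoid ℓ ℓ} (f : Op A J) (g : Op A Y) (a : Func (J ×ₛ Y) A) →
                       let h = compose g (columnProjections a) in
                       Setoid._≈_ A (h ⟨$⟩ f) (f ⟨$⟩ function (proj A J) h) →
                       Setoid._≈_ A (g ⟨$⟩ onColumns a f) (f ⟨$⟩ onRows a g)
  evaluation⇒commute {J} f g a hf≈fhu = begin
    g ⟨$⟩ onColumns a f           ≈⟨ Func.cong g (λ y → refl) ⟩
    h ⟨$⟩ f                       ≈⟨ hf≈fhu ⟩
    f ⟨$⟩ function (proj A J) h   ≈⟨ Func.cong f (λ j → Func.cong g (λ y → refl)) ⟩
    f ⟨$⟩ onRows a g              ∎
    where
    open SetoidReasoning A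
    h = compose g (columnProjections a)

theorem5p3 :
    ∀ {ℓ j p} (α : RegularCardinal≤κ ℓ) (𝔍 : Pred (Setoid ℓ ℓ) j) → IsArities α 𝔍 →
    ∀ (A : Setoid ℓ ℓ) (G : OpSet A p) → IsAry 𝔍 G →
    ∀ (J : Setoid ℓ ℓ) → 𝔍 J → (f : Op A J) →
    let open Setoid A using (_≈_)
        u : Func J (A ^ (A ^ J))
        u = proj A J
        [1] = mem (Centralizer 𝔍 G) J f
        [2] = ∀ (h : Op A (A ^ J)) → mem ⟨ G ⟩ (A ^ J) h → (h ⟨$⟩ f) ≈ (f ⟨$⟩ function u h)
        [3] = ∀ (h : Op A (A ^ J)) → mem ⟨ G ⟩ (A ^ J) h → Commute A J (A ^ J) f h
    in ([1] ⇔ [2]) × ([2] ⇔ [3])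
theorem5p3 α 𝔍 _ A G _ J J∈𝔍 f =
  -- Both equivalences come from the cycle (1) ⇒ (3) ⇒ (2) ⇒ (1).
  mk⇔ (3⇒2 ∘ 1⇒3) 2⇒1 , mk⇔ (1⇒3 ∘ 2⇒1) 3⇒2
  where
  open Setoid A using (_≈_)
  [1] = mem (Centralizer 𝔍 G) J f
  [2] = ∀ (h : Op A (A ^ J)) → mem ⟨ G ⟩ (A ^ J) h → (h ⟨$⟩ f) ≈ (f ⟨$⟩ function (proj A J) h)
  [3] = ∀ (h : Op A (A ^ J)) → mem ⟨ G ⟩ (A ^ J) h → Commute A J (A ^ J) f h

  1⇒3 : [1] → [3]
  1⇒3 (_ , f⊥G) h h∈ = commute-⟨⟩ G f f⊥G h∈

  3⇒2 : [3] → [2]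
  3⇒2 f⊥⟨G⟩ h h∈ = commute⇒evaluation f h (f⊥⟨G⟩ h h∈)

  2⇒1 : [2] → [1]
  2⇒1 eval = J∈𝔍 , λ Y g g∈G a →
    evaluation⇒commute f g a
      -- Composing with projections turns `g`, of arbitrary arity `Y`, into a member of `⟨ G ⟩` of
      -- arity `A ^ J`, to which (2) applies.
      (eval (compose g (columnProjections a))
            (cmp g (columnProjections a) (gen g∈G) (λ y → prj (A ^ J) (column a y))))
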